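{- There exists an absolute constant $C>0$ such that for every finite connected vertex-transitive directed graph $\Gamma$ on $n$ vertices, \[ \overrightarrow{\mathrm{diam}}(\Gamma) \leq C\cdot \mathrm{diam}(\Gamma)^2 (\log n)^2, \] i.e. $\overrightarrow{\mathrm{diam}}(\Gamma) = O(\mathrm{diam}(\Gamma)^2(\log n)^2)$.
   Context: A (directed) graph on a finite vertex set $\Omega$ is a relation $\Gamma\subseteq\Omega\times\Omega$ (loops allowed); $(\alpha,\beta)\in\Gamma$ is a directed edge from $\alpha$ to $\beta$. $\Gamma$ is vertex-transitive if its automorphism group (permutations of $\Omega$ preserving $\Gamma$) acts transitively on $\Omega$. The directed diameter $\overrightarrow{\mathrm{diam}}(\Gamma)$ is the maximum over ordered pairs of vertices $(\alpha,\beta)$ of the length of a shortest path from $\alpha$ to $\beta$ that respects edge orientations. The undirected diameter $\mathrm{diam}(\Gamma)$ is the maximum distance between two vertices when edge orientations are ignored, i.e. $\mathrm{diam}(\Gamma)=\overrightarrow{\mathrm{diam}}(\Gamma\cup\Gamma^*)$ with $\Gamma^*=\{(\beta,\alpha)\mid(\alpha,\beta)\in\Gamma\}$. Connected means that any two vertices are joined by a path ignoring orientations; for finite vertex-transitive directed graphs this is equivalent to strong connectivity, so the directed diameter is finite. $\log$ is the base-2 logarithm. -}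

module Defs where

open import Level using (0ℓ)
open import Data.Fin using (Fin)
open import Data.Fin.Permutation using (Permutation′; _⟨$⟩ʳ_)
open import Data.Nat using (ℕ; zero; suc; _*_; _^_; _≤_; NonZero)
open import Data.Nat.Properties using (≤-antisym)
open import Data.Product using (_×_; _,_; ∃-syntax)
open import Function.Bundles using (_⇔_)
open import Relation.Binary.Core using (Rel)
open import Relation.Binary.Definitions using (Decidable)
open import Relation.Binary.PropositionalEquality using (_≡_; refl)
open import Relation.Binary.Construct.Closure.ReflexiveTransitive using (Star; ε; _◅_)
open import Relation.Binary.Construct.Closure.Symmetric using (SymClosure)
open import Relation.Binary.Construct.Closure.Equivalence using (EqClosure)

-- Membership of a pair in the edge set is decidable: the edge set is a
-- finite set in the ordinary sense.
record Digraph (n : ℕ) : Set₁ where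
  field
    Edge  : Rel (Fin n) 0ℓ
    edge? : Decidable Edge

open Digraph public

IsAutomorphism : ∀ {n} → Digraph n → Permutation′ n → Set
IsAutomorphism Γ σ = ∀ α β → Edge Γ α β ⇔ Edge Γ (σ ⟨$⟩ʳ α) (σ ⟨$⟩ʳ β)

VertexTransitive : ∀ {n} → Digraph n → Set
VertexTransitive {n} Γ =
  ∀ α β → ∃[ σ ] (IsAutomorphism Γ σ × σ ⟨$⟩ʳ α ≡ β)

Connected : ∀ {n} → Digraph n → Set
Connected Γ = ∀ α β → EqClosure (Edge Γ) α β

module _ {A : Set} where

  length : {R : Rel A 0ℓ} {α β : A} → Star R α β → ℕ
  length ε       = zero
  length (_ ◅ w) = suc (length w)

  -- Vertices may repeat along an element of Star R; a shortest one
  -- never repeats a vertex, so distances agree with those measured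
  -- along paths.
  IsDistance : Rel A 0ℓ → A → A → ℕ → Set
  IsDistance R α β k =
    (∃[ w ] length {R} {α} {β} w ≡ k) ×
    (∀ (w : Star R α β) → k ≤ length w)

  -- d is the maximum of the distances over all ordered pairs. In
  -- particular all distances are finite.
  IsMaxDistance : Rel A 0ℓ → ℕ → Set
  IsMaxDistance R d =
    (∀ α β → ∃[ k ] (IsDistance R α β k × k ≤ d)) ×
    (∃[ α ] ∃[ β ] IsDistance R α β d)

  distance-unique : ∀ {R α β k l} →
                    IsDistance R α β k → IsDistance R α β l → k ≡ l
  distance-unique ((v , refl) , k≤) ((w , refl) , l≤) = ≤-antisym (k≤ w) (l≤ v)

  maxDistance-unique : ∀ {R d e} →
                       IsMaxDistance R d → IsMaxDistance R e → d ≡ e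
  maxDistance-unique {R} d-max e-max =
    ≤-antisym (attained≤ d-max e-max) (attained≤ e-max d-max)
    where
    attained≤ : ∀ {d e} → IsMaxDistance R d → IsMaxDistance R e → d ≤ e
    attained≤ (_ , α , β , δ) (bound , _) with bound α β
    ... | k , δ′ , k≤e rewrite distance-unique δ δ′ = k≤e

IsDirectedDiameter : ∀ {n} → Digraph n → ℕ → Set
IsDirectedDiameter Γ = IsMaxDistance (Edge Γ)

IsDiameter : ∀ {n} → Digraph n → ℕ → Set
IsDiameter Γ = IsMaxDistance (SymClosure (Edge Γ))

-- For n ≥ 1 this is exactly the real inequality a ≤ b (log₂ n)².  The
-- real number log₂ n ≥ 0 is given by its upper Dedekind cut: a fraction
-- p / q satisfies log₂ n ≤ p / q iff n ^ q ≤ 2 ^ p.  As x ↦ b x² is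
-- continuous and increasing on x ≥ 0, the real inequality holds iff
-- a ≤ b (p / q)² for every such fraction.
_≤_*[log₂_]² : ℕ → ℕ → ℕ → Set
a ≤ b *[log₂ n ]² =
  ∀ p q → .{{NonZero q}} → n ^ q ≤ 2 ^ p → a * q ^ 2 ≤ b * p ^ 2

{-# OPTIONS --safe #-}

-- For a vertex-transitive Γ all out-balls and all in-balls of radius k have the
-- same size s(k).  The out-balls of radius k around the two ends of an edge lie
-- in one ball of radius k + 1, so they differ in at most s(k+1) − s(k) vertices,
-- whichever way the edge points.  Hence by the triangle inequality any two of
-- these balls differ in at most d (s(k+1) − s(k)) vertices, whereas on average
-- they differ in s(k) − s(k)²/n.  So s(k+1) ≥ (1 + 1/2d) s(k) as long as
-- 2 s(k) ≤ n, and s doubles every 2d steps: 2 s(k) > n for k = 2d ⌊log₂ n⌋.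
-- Then every out-ball of radius k meets every in-ball of radius k, and the
-- directed diameter is at most 2k = 4d ⌊log₂ n⌋.
module Submission where

open import Defs
open import Data.Fin using (Fin; zero; suc; _≟_)
open import Data.Fin.Permutation using (_⟨$⟩ʳ_; _⟨$⟩ˡ_; inverseˡ; inverseʳ)
open import Data.Fin.Properties using (any?; nonZeroIndex)
open import Data.Nat hiding (_≟_)
open import Data.Nat.Properties hiding (_≟_)
open import Algebra.Properties.Semiring.Sum +-*-semiring
open import Data.Nat.Tactic.RingSolver using (solve-∀)
open import Data.Product using (_×_; _,_; ∃-syntax; proj₁; proj₂)
open import Data.Sum using (_⊎_; inj₁; inj₂; [_,_]′)
open import Function using (_∘_; _⇔_; Equivalence; mk⇔)
open import Level using (0ℓ)
open import Relation.Binary.Construct.Closure.ReflexiveTransitive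
  using (Star; ε; _◅_; _◅◅_; gmap)
open import Relation.Binary.Construct.Closure.Symmetric using (SymClosure; fwd; bwd)
open import Relation.Binary.Core using (Rel)
open import Relation.Binary.Definitions using (Decidable)
open import Relation.Binary.PropositionalEquality
open import Relation.Nullary
  using (Dec; yes; no; ¬_; contradiction; map′; _×-dec_; _⊎-dec_)
import Relation.Unary as U

-- Arithmetic

≤-least : {P : ℕ → Set} → U.Decidable P → ∀ {k} → P k →
          ∃[ m ] (P m × (∀ {j} → P j → m ≤ j))
≤-least P? {zero} p = 0 , p , λ _ → z≤n
≤-least {P} P? {suc k} p with P? 0
... | yes p₀ = 0 , p₀ , λ _ → z≤n
... | no ¬p₀ with ≤-least (P? ∘ suc) p
...   | m , pm , least = suc m , pm , λ
        { {zero} p₀ → contradiction p₀ ¬p₀ ; {suc j} pj → s≤s (least pj) }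

argmax : ∀ {n} (f : Fin (suc n) → ℕ) → ∃[ i ] (∀ j → f j ≤ f i)
argmax {zero}  f = zero , λ { zero → ≤-refl }
argmax {suc n} f with argmax (f ∘ suc)
... | i , f≤fi with ≤-total (f zero) (f (suc i))
...   | inj₁ f₀≤fi = suc i , λ { zero → f₀≤fi ; (suc j) → f≤fi j }
...   | inj₂ fi≤f₀ = zero  , λ { zero → ≤-refl ; (suc j) → ≤-trans (f≤fi j) fi≤f₀ }

m≤m² : ∀ m → m ≤ m ^ 2
m≤m² zero      = z≤n
m≤m² m@(suc _) = subst (m ≤_) (cong (m *_) (sym (*-identityʳ m))) (m≤m*n m m)

2^-cancel-≤ : ∀ {m n} → 2 ^ m ≤ 2 ^ n → m ≤ n
2^-cancel-≤ {m} {n} 2^m≤2^n with m ≤? n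
... | yes m≤n = m≤n
... | no  m≰n = contradiction 2^m≤2^n (<⇒≱ (^-monoʳ-< 2 (s≤s (s≤s z≤n)) (≰⇒> m≰n)))

-- Here `l` is the integer part of log₂ of `suc n`. The lower bound compares `l` with the logarithm;
-- the upper one ensures that `l` doublings suffice to pass half of the vertices.
2^-bracket : ∀ n → ∃[ l ] (2 ^ l ≤ suc n × suc n < 2 ^ suc l)
2^-bracket zero = 0 , ≤-refl , ≤-refl
2^-bracket (suc n) with 2^-bracket n
... | l , lo , hi with suc (suc n) <? 2 ^ suc l
...   | yes hi′ = l , m≤n⇒m≤1+n lo , hi′
...   | no  ¬hi = suc l , ≮⇒≥ ¬hi , <-≤-trans (s≤s hi)
          (subst (suc (2 ^ suc l) ≤_) (cong (2 ^ suc l +_) (sym (+-identityʳ _)))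
                 (+-monoˡ-≤ (2 ^ suc l) (m^n>0 2 (suc l))))

-- The hypotheses 0 < s and s + 2ds ≤ 2du only serve to exclude d = 0.
halve : ∀ d {s t u} → 0 < s → s + 2 * d * s ≤ 2 * d * u →
        (2 * d + 2 * d) * s ≤ 2 * d * t → 2 * s ≤ t
halve zero      0<s s≤0 _ = contradiction s≤0 (<⇒≱ (≤-trans 0<s (m≤m+n _ 0)))
halve d@(suc _) {s} {t} _ _ le = *-cancelˡ-≤ (2 * d) (subst (_≤ 2 * d * t) (regroup d s) le)
  where
  regroup : ∀ d s → (2 * d + 2 * d) * s ≡ 2 * d * (2 * s)
  regroup = solve-∀

-- From `2 ^ l ≤ n` and `n ^ q ≤ 2 ^ p` follows `l * q ≤ p`, so `l` lies below every fraction of the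
-- cut. The bound linear in `d` and `l` is weakened to squares by `m≤m²`.
linear⇒≤*log² : ∀ {n} D d l → 2 ^ l ≤ n → D ≤ 4 * d * l → D ≤ 4 * d ^ 2 *[log₂ n ]²
linear⇒≤*log² {n} D d l 2^l≤n D≤4dl p q n^q≤2^p = begin
  D * q ^ 2                       ≤⟨ *-monoˡ-≤ (q ^ 2) D≤4dl ⟩
  4 * d * l * q ^ 2               ≤⟨ *-monoˡ-≤ (q ^ 2) (*-mono-≤ (*-monoʳ-≤ 4 (m≤m² d)) (m≤m² l)) ⟩
  4 * d ^ 2 * l ^ 2 * q ^ 2       ≡⟨ regroup d l q ⟩
  4 * d ^ 2 * (l * q) ^ 2         ≤⟨ *-monoʳ-≤ (4 * d ^ 2) (^-monoˡ-≤ 2 lq≤p) ⟩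
  4 * d ^ 2 * p ^ 2               ∎
  where
  open ≤-Reasoning
  regroup : ∀ d l q → 4 * (d * (d * 1)) * (l * (l * 1)) * (q * (q * 1)) ≡
                      4 * (d * (d * 1)) * (l * q * (l * q * 1))
  regroup = solve-∀
  lq≤p : l * q ≤ p
  lq≤p = 2^-cancel-≤ (begin
    2 ^ (l * q)  ≡⟨ ^-*-assoc 2 l q ⟨
    (2 ^ l) ^ q  ≤⟨ ^-monoˡ-≤ q 2^l≤n ⟩
    n ^ q        ≤⟨ n^q≤2^p ⟩
    2 ^ p        ∎)

-- Sums and indicators

∑-mono-≤ : ∀ {n} {f g : Fin n → ℕ} → (∀ i → f i ≤ g i) → ∑[ i < n ] f i ≤ ∑[ i < n ] g i
∑-mono-≤ {zero}  f≤g = z≤n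
∑-mono-≤ {suc n} f≤g = +-mono-≤ (f≤g zero) (∑-mono-≤ (f≤g ∘ suc))

∑-const : ∀ n {c} → ∑[ i < n ] c ≡ n * c
∑-const zero        = refl
∑-const (suc n) {c} = cong (c +_) (∑-const n)

f≤∑f : ∀ {n} (f : Fin n → ℕ) i → f i ≤ ∑[ j < n ] f j
f≤∑f {suc n} f i = subst (f i ≤_) (sym (sum-remove f)) (m≤m+n (f i) _)

𝟙 : {P : Set} → Dec P → ℕ
𝟙 (yes _) = 1
𝟙 (no  _) = 0

module _ {P Q : Set} where

  𝟙-mono : (P? : Dec P) (Q? : Dec Q) → (P → Q) → 𝟙 P? ≤ 𝟙 Q?
  𝟙-mono (no _)  _        _   = z≤n
  𝟙-mono (yes _) (yes _)  _   = ≤-refl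
  𝟙-mono (yes p) (no ¬q)  P→Q = contradiction (P→Q p) ¬q

  𝟙-disjoint : (P? : Dec P) (Q? : Dec Q) → ¬ (P × Q) → 𝟙 P? + 𝟙 Q? ≤ 1
  𝟙-disjoint (no _)  (no _)  _  = z≤n
  𝟙-disjoint (no _)  (yes _) _  = ≤-refl
  𝟙-disjoint (yes _) (no _)  _  = ≤-refl
  𝟙-disjoint (yes p) (yes q) ¬× = contradiction (p , q) ¬×

𝟙-cong : {P Q : Set} (P? : Dec P) (Q? : Dec Q) → P ⇔ Q → 𝟙 P? ≡ 𝟙 Q?
𝟙-cong P? Q? P⇔Q =
  ≤-antisym (𝟙-mono P? Q? (Equivalence.to P⇔Q)) (𝟙-mono Q? P? (Equivalence.from P⇔Q))

𝟙-idem : {P : Set} (P? : Dec P) → 𝟙 P? * 𝟙 P? ≡ 𝟙 P?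
𝟙-idem (yes _) = refl
𝟙-idem (no _)  = refl

𝟙-yes : {P : Set} (P? : Dec P) → P → 𝟙 P? ≡ 1
𝟙-yes (yes _) _ = refl
𝟙-yes (no ¬p) p = contradiction p ¬p

module _ {P Q S : Set} where

  -- Inclusion-exclusion at one point, with the union enlarged to `S`.
  𝟙-∪ : (P? : Dec P) (Q? : Dec Q) (S? : Dec S) → (P → S) → (Q → S) →
        𝟙 P? + 𝟙 Q? ≤ 𝟙 S? + 𝟙 P? * 𝟙 Q?
  𝟙-∪ (no _)  (no _)  _       _   _   = z≤n
  𝟙-∪ (no _)  (yes _) (yes _) _   _   = ≤-refl
  𝟙-∪ (no _)  (yes q) (no ¬s) _   Q→S = contradiction (Q→S q) ¬s
  𝟙-∪ (yes _) (no _)  (yes _) _   _   = ≤-refl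
  𝟙-∪ (yes _) (yes _) (yes _) _   _   = ≤-refl
  𝟙-∪ (yes p) _       (no ¬s) P→S _   = contradiction (P→S p) ¬s

  -- P ∩ Q and Q ∩ S both lie in Q, and their overlap lies in P ∩ S.
  𝟙-triangle : (P? : Dec P) (Q? : Dec Q) (S? : Dec S) →
               𝟙 P? * 𝟙 Q? + 𝟙 Q? * 𝟙 S? ≤ 𝟙 Q? + 𝟙 P? * 𝟙 S?
  𝟙-triangle (no _)  (no _)  _       = z≤n
  𝟙-triangle (no _)  (yes _) (no _)  = z≤n
  𝟙-triangle (no _)  (yes _) (yes _) = ≤-refl
  𝟙-triangle (yes _) (no _)  _       = z≤n
  𝟙-triangle (yes _) (yes _) (no _)  = ≤-refl
  𝟙-triangle (yes _) (yes _) (yes _) = ≤-refl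

-- Walks of bounded length

module _ {A : Set} {R : Rel A 0ℓ} where

  Within : ℕ → Rel A 0ℓ
  Within k α β = ∃[ w ] (length {R = R} {α} {β} w ≤ k)

  Within-mono : ∀ {j k α β} → j ≤ k → Within j α β → Within k α β
  Within-mono j≤k (w , w≤j) = w , ≤-trans w≤j j≤k

  Within-step : ∀ {k α β γ} → R α β → Within k β γ → Within (suc k) α γ
  Within-step r (w , w≤k) = r ◅ w , s≤s w≤k

  length-◅◅ : ∀ {α β γ} (v : Star R α β) (w : Star R β γ) →
              length (v ◅◅ w) ≡ length v + length w
  length-◅◅ ε       w = refl
  length-◅◅ (_ ◅ v) w = cong suc (length-◅◅ v w)

  Within-trans : ∀ {j k α β γ} → Within j α β → Within k β γ → Within (j + k) α γ
  Within-trans (v , v≤j) (w , w≤k) =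
    v ◅◅ w , subst (_≤ _) (sym (length-◅◅ v w)) (+-mono-≤ v≤j w≤k)

  Within-map : (f : A → A) → (∀ {α β} → R α β → R (f α) (f β)) →
               ∀ {k α β} → Within k α β → Within k (f α) (f β)
  Within-map f f-hom (w , w≤k) = gmap f f-hom w , subst (_≤ _) (sym (length-gmap w)) w≤k
    where
    length-gmap : ∀ {α β} (w : Star R α β) → length (gmap {U = R} f f-hom w) ≡ length w
    length-gmap ε       = refl
    length-gmap (_ ◅ w) = cong suc (length-gmap w)

module _ {n} {R : Rel (Fin n) 0ℓ} (R? : Decidable R) where

  within? : ∀ k → Decidable (Within {R = R} k)
  within? zero α β = map′ (λ { refl → ε , z≤n }) (λ { (ε , _) → refl }) (α ≟ β)
  within? (suc k) α β = map′
    (λ { (inj₁ refl) → ε , z≤n ; (inj₂ (_ , r , p)) → Within-step r p })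
    (λ { (ε , _) → inj₁ refl ; (r ◅ w , s≤s w≤k) → inj₂ (_ , r , w , w≤k) })
    (α ≟ β ⊎-dec any? (λ γ → R? α γ ×-dec within? k γ β))

  -- The length of the given walk bounds the search; a walk found within the least radius has
  -- exactly that length.
  distance : ∀ {α β} → Star R α β → ∃[ k ] IsDistance R α β k
  distance {α} {β} w with ≤-least (λ k → within? k α β) (w , ≤-refl)
  ... | k , (v , v≤k) , least = k , (v , ≤-antisym v≤k (least (v , ≤-refl))) ,
                                λ u → least (u , ≤-refl)

maxDistance : ∀ {n} .{{_ : NonZero n}} {R : Rel (Fin n) 0ℓ} → Decidable R →
              (∀ α β → Star R α β) → ∃[ d ] IsMaxDistance R d
maxDistance {suc n} {R} R? conn =
  dist α* (farthest α*) ,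
  (λ α β → dist α β , proj₂ (distance R? (conn α β)) ,
     ≤-trans (proj₂ (argmax (dist α)) β) (proj₂ (argmax eccentricity) α)) ,
  α* , farthest α* , proj₂ (distance R? (conn α* (farthest α*)))
  where
  dist : Fin (suc n) → Fin (suc n) → ℕ
  dist α β = proj₁ (distance R? (conn α β))
  farthest : Fin (suc n) → Fin (suc n)
  farthest α = proj₁ (argmax (dist α))
  eccentricity : Fin (suc n) → ℕ
  eccentricity α = dist α (farthest α)
  α* : Fin (suc n)
  α* = proj₁ (argmax eccentricity)

maxDistance⇒within : ∀ {A : Set} {R : Rel A 0ℓ} {d} → IsMaxDistance R d →
                     ∀ α β → Within {R = R} d α β
maxDistance⇒within (bound , _) α β with bound α β
... | _ , ((w , refl) , _) , w≤d = w , w≤d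

within⇒maxDistance≤ : ∀ {A : Set} {R : Rel A 0ℓ} {d k} → IsMaxDistance R d →
                      (∀ α β → Within {R = R} k α β) → d ≤ k
within⇒maxDistance≤ (_ , α , β , _ , d≤) within with within α β
... | w , w≤k = ≤-trans (d≤ w) w≤k

symClosure? : ∀ {A : Set} {R : Rel A 0ℓ} → Decidable R → Decidable (SymClosure R)
symClosure? R? α β =
  map′ [ fwd , bwd ]′ (λ { (fwd r) → inj₁ r ; (bwd r) → inj₂ r }) (R? α β ⊎-dec R? β α)

-- Growth of balls

module Balls {n} (Γ : Digraph n) (transitive : VertexTransitive Γ) (ω : Fin n) where

  private instance
    n≢0 : NonZero n
    n≢0 = nonZeroIndex ω

  ball? : ∀ k → Decidable (Within {R = Edge Γ} k)
  ball? = within? (edge? Γ)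

  ball : ℕ → Fin n → Fin n → ℕ
  ball k α β = 𝟙 (ball? k α β)

  ball-auto : ∀ k σ → IsAutomorphism Γ σ → ∀ α β →
              ball k α β ≡ ball k (σ ⟨$⟩ʳ α) (σ ⟨$⟩ʳ β)
  ball-auto k σ aut α β = 𝟙-cong (ball? k _ _) (ball? k _ _) (mk⇔
    (Within-map (σ ⟨$⟩ʳ_) (Equivalence.to (aut _ _)))
    (λ p → subst₂ (Within k) (inverseˡ σ) (inverseˡ σ)
      (Within-map (σ ⟨$⟩ˡ_) (λ e → Equivalence.from (aut _ _)
        (subst₂ (Edge Γ) (sym (inverseʳ σ)) (sym (inverseʳ σ)) e)) p)))

  size : ℕ → ℕ
  size k = ∑[ δ < n ] ball k ω δ

  out-size : ∀ k α → ∑[ δ < n ] ball k α δ ≡ size k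
  out-size k α with transitive α ω
  ... | σ , aut , refl = trans (sum-cong-≗ (ball-auto k σ aut α)) (sym (∑-permute (ball k ω) σ))

  -- Double counting: transitivity makes all in-balls equally large, and the pairs in `Within k`,
  -- counted by target or by source, number `n` times either size.
  in-size : ∀ k β → ∑[ γ < n ] ball k γ β ≡ size k
  in-size k β = *-cancelˡ-≡ _ _ n (begin
    n * ∑[ γ < n ] ball k γ β             ≡⟨ ∑-const n ⟨
    ∑[ δ < n ] ∑[ γ < n ] ball k γ β      ≡⟨ sum-cong-≗ in-const ⟩
    ∑[ δ < n ] ∑[ γ < n ] ball k γ δ      ≡⟨ ∑-comm (λ δ γ → ball k γ δ) ⟩
    ∑[ γ < n ] ∑[ δ < n ] ball k γ δ      ≡⟨ sum-cong-≗ (out-size k) ⟩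
    ∑[ γ < n ] size k                     ≡⟨ ∑-const n ⟩
    n * size k                            ∎)
    where
    open ≡-Reasoning
    in-const : ∀ δ → ∑[ γ < n ] ball k γ β ≡ ∑[ γ < n ] ball k γ δ
    in-const δ with transitive β δ
    ... | σ , aut , refl = trans (sum-cong-≗ (λ γ → ball-auto k σ aut γ β))
                                 (sym (∑-permute (λ γ → ball k γ δ) σ))

  size-mono-≤ : ∀ {j k} → j ≤ k → size j ≤ size k
  size-mono-≤ j≤k = ∑-mono-≤ λ δ → 𝟙-mono (ball? _ ω δ) (ball? _ ω δ) (Within-mono j≤k)

  0<size : ∀ k → 0 < size k
  0<size k = subst (_≤ size k) (𝟙-yes (ball? k ω ω) (ε , z≤n)) (f≤∑f (ball k ω) ω)

  -- Overlaps of out-balls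

  both : ℕ → Fin n → Fin n → Fin n → ℕ
  both k α β δ = ball k α δ * ball k β δ

  -- Overlaps encode differences without truncated subtraction: all out-balls have size s(k), so
  -- |B(α) ∖ B(β)| is s(k) minus this number.
  common : ℕ → Fin n → Fin n → ℕ
  common k α β = ∑[ δ < n ] both k α β δ

  common-refl : ∀ k α → common k α α ≡ size k
  common-refl k α = trans (sum-cong-≗ (λ δ → 𝟙-idem (ball? k α δ))) (out-size k α)

  common-comm : ∀ k α β → common k α β ≡ common k β α
  common-comm k α β = sum-cong-≗ (λ δ → *-comm (ball k α δ) (ball k β δ))

  -- This is |B(α) ∖ B(γ)| ≤ |B(α) ∖ B(β)| + |B(β) ∖ B(γ)|, rewritten through overlaps.
  common-triangle : ∀ k α β γ → common k α β + common k β γ ≤ size k + common k α γ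
  common-triangle k α β γ = begin
    common k α β + common k β γ
      ≡⟨ ∑-distrib-+ (both k α β) (both k β γ) ⟨
    ∑[ δ < n ] (both k α β δ + both k β γ δ)
      ≤⟨ ∑-mono-≤ (λ δ → 𝟙-triangle (ball? k α δ) (ball? k β δ) (ball? k γ δ)) ⟩
    ∑[ δ < n ] (ball k β δ + both k α γ δ)
      ≡⟨ ∑-distrib-+ (ball k β) (both k α γ) ⟩
    ∑[ δ < n ] ball k β δ + common k α γ
      ≡⟨ cong (_+ common k α γ) (out-size k β) ⟩
    size k + common k α γ ∎
    where open ≤-Reasoning

  -- Both balls lie in the ball of radius k + 1 around the tail α, the second because the edge can
  -- be prepended to walks from β.
  common-edge : ∀ k {α β} → Edge Γ α β →
                 size k + size k ≤ size (suc k) + common k α β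
  common-edge k {α} {β} e = begin
    size k + size k
      ≡⟨ cong₂ _+_ (out-size k α) (out-size k β) ⟨
    ∑[ δ < n ] ball k α δ + ∑[ δ < n ] ball k β δ
      ≡⟨ ∑-distrib-+ (ball k α) (ball k β) ⟨
    ∑[ δ < n ] (ball k α δ + ball k β δ)
      ≤⟨ ∑-mono-≤ (λ δ → 𝟙-∪ (ball? k α δ) (ball? k β δ) (ball? (suc k) α δ)
                              (Within-mono (n≤1+n k)) (Within-step e)) ⟩
    ∑[ δ < n ] (ball (suc k) α δ + both k α β δ)
      ≡⟨ ∑-distrib-+ (ball (suc k) α) (both k α β) ⟩
    ∑[ δ < n ] ball (suc k) α δ + common k α β
      ≡⟨ cong (_+ common k α β) (out-size (suc k) α) ⟩
    size (suc k) + common k α β ∎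
    where open ≤-Reasoning

  -- Orientation drops out here: overlaps are symmetric in the two ends, and the size of the
  -- enclosing ball does not depend on its centre.
  common-symEdge : ∀ k {α β} → SymClosure (Edge Γ) α β →
                    size k + size k ≤ size (suc k) + common k α β
  common-symEdge k (fwd e) = common-edge k e
  common-symEdge k {α} {β} (bwd e) =
    subst (λ o → size k + size k ≤ size (suc k) + o) (common-comm k β α) (common-edge k e)

  -- |B(α) ∖ B(γ)| ≤ j (s(k+1) − s(k)), where |B(α) ∖ B(γ)| = s(k) − common k α γ
  -- and the subtracted terms have been moved across.
  common-walk : ∀ k {α γ} (w : Star (SymClosure (Edge Γ)) α γ) →
                 size k + length w * size k ≤ length w * size (suc k) + common k α γ
  common-walk k {α} ε = ≤-reflexive (trans (+-identityʳ _) (sym (common-refl k α)))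
  -- The triangle inequality brings an extra `s` on the right, so `s` is first added to both sides.
  common-walk k {α} {γ} (_◅_ {j = β} e w) = +-cancelˡ-≤ s _ _ (begin
    s + (s + suc j * s)                                ≡⟨ split s j ⟩
    s + s + (s + j * s)                                ≤⟨ +-mono-≤ (common-symEdge k e) (common-walk k w) ⟩
    (s′ + common k α β) + (j * s′ + common k β γ)    ≡⟨ shuffle s′ j _ _ ⟩
    suc j * s′ + (common k α β + common k β γ)       ≤⟨ +-monoʳ-≤ (suc j * s′) (common-triangle k α β γ) ⟩
    suc j * s′ + (s + common k α γ)                   ≡⟨ swap (suc j * s′) s _ ⟩
    s + (suc j * s′ + common k α γ)                   ∎)
    where
    open ≤-Reasoning
    s  = size k
    s′ = size (suc k)
    j  = length w
    split : ∀ s j → s + (s + suc j * s) ≡ s + s + (s + j * s)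
    split = solve-∀
    shuffle : ∀ s′ j a b → (s′ + a) + (j * s′ + b) ≡ suc j * s′ + (a + b)
    shuffle = solve-∀
    swap : ∀ a b c → a + (b + c) ≡ b + (a + c)
    swap = solve-∀

  -- Each δ in B(α) lies in B(γ) for exactly s(k) vertices γ, those of the in-ball at δ.
  ∑-common : ∀ k α → ∑[ γ < n ] common k α γ ≡ size k * size k
  ∑-common k α = begin
    ∑[ γ < n ] ∑[ δ < n ] both k α γ δ
      ≡⟨ ∑-comm (both k α) ⟩
    ∑[ δ < n ] ∑[ γ < n ] (ball k α δ * ball k γ δ)
      ≡⟨ sum-cong-≗ (λ δ → *-distribˡ-sum (ball k α δ) (λ γ → ball k γ δ)) ⟨
    ∑[ δ < n ] (ball k α δ * ∑[ γ < n ] ball k γ δ)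
      ≡⟨ sum-cong-≗ (λ δ → cong (ball k α δ *_) (in-size k δ)) ⟩
    ∑[ δ < n ] (ball k α δ * size k)
      ≡⟨ *-distribʳ-sum (size k) (ball k α) ⟨
    (∑[ δ < n ] ball k α δ) * size k
      ≡⟨ cong (_* size k) (out-size k α) ⟩
    size k * size k ∎
    where open ≡-Reasoning

  -- Pigeonhole: an out-ball and an in-ball with more than `n` elements in total share a vertex,
  -- where two walks are joined.
  balls-meet : ∀ k → n < size k + size k → ∀ α β → Within {R = Edge Γ} (k + k) α β
  balls-meet k n<2s α β with any? (λ δ → ball? k α δ ×-dec ball? k δ β)
  ... | yes (_ , p , q) = Within-trans p q
  ... | no  disjoint    = contradiction n<2s (≤⇒≯ (begin
    size k + size k                                  ≡⟨ cong₂ _+_ (out-size k α) (in-size k β) ⟨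
    ∑[ δ < n ] ball k α δ + ∑[ δ < n ] ball k δ β    ≡⟨ ∑-distrib-+ (ball k α) (λ δ → ball k δ β) ⟨
    ∑[ δ < n ] (ball k α δ + ball k δ β)
      ≤⟨ ∑-mono-≤ (λ δ → 𝟙-disjoint (ball? k α δ) (ball? k δ β) (disjoint ∘ (δ ,_))) ⟩
    ∑[ δ < n ] 1                                     ≡⟨ ∑-const n ⟩
    n * 1                                            ≡⟨ *-identityʳ n ⟩
    n                                                ∎))
    where open ≤-Reasoning

  -- Expansion and doubling of ball sizes

  module _ {d} (diam≤d : ∀ α β → Within {R = SymClosure (Edge Γ)} d α β) where

    common-lower : ∀ k α γ → size k + d * size k ≤ d * size (suc k) + common k α γ
    common-lower k α γ with diam≤d α γ
    ... | w , j≤d with m≤n⇒∃[o]m+o≡n j≤d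
    -- The `e` steps by which the walk falls short of `d` are filled in by s(k) ≤ s(k+1).
    ...   | e , refl = begin
      s + (j + e) * s                       ≡⟨ split s j e ⟩
      (s + j * s) + e * s                   ≤⟨ +-mono-≤ (common-walk k w) (*-monoʳ-≤ e (size-mono-≤ (n≤1+n k))) ⟩
      (j * s′ + common k α γ) + e * s′     ≡⟨ join j e s′ _ ⟩
      (j + e) * s′ + common k α γ          ∎
      where
      open ≤-Reasoning
      s  = size k
      s′ = size (suc k)
      j  = length w
      split : ∀ s j e → s + (j + e) * s ≡ (s + j * s) + e * s
      split = solve-∀
      join : ∀ j e s′ o → (j * s′ + o) + e * s′ ≡ (j + e) * s′ + o
      join = solve-∀

    -- Averaging `common-lower` over γ: the mean overlap s²/n is at most s/2, so d (s′ - s) ≥ s/2.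
    expansion : ∀ k → size k + size k ≤ n → size k + 2 * d * size k ≤ 2 * d * size (suc k)
    -- The added `n * s` absorbs the doubled s², which is at most `n * s`.
    expansion k 2s≤n = *-cancelˡ-≤ n (+-cancelˡ-≤ (n * s) _ _ (begin
      n * s + n * (s + 2 * d * s)          ≡⟨ double n s d ⟩
      2 * (n * (s + d * s))                ≤⟨ *-monoʳ-≤ 2 averaged ⟩
      2 * (n * (d * s′) + s * s)           ≡⟨ separate n d s s′ ⟩
      (s + s) * s + n * (2 * d * s′)       ≤⟨ +-monoˡ-≤ (n * (2 * d * s′)) (*-monoˡ-≤ s 2s≤n) ⟩
      n * s + n * (2 * d * s′)             ∎))
      where
      open ≤-Reasoning
      s  = size k
      s′ = size (suc k)
      averaged : n * (s + d * s) ≤ n * (d * s′) + s * s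
      averaged = begin
        n * (s + d * s)                                      ≡⟨ ∑-const n ⟨
        ∑[ γ < n ] (s + d * s)                               ≤⟨ ∑-mono-≤ (common-lower k ω) ⟩
        ∑[ γ < n ] (d * s′ + common k ω γ)                  ≡⟨ ∑-distrib-+ (λ _ → d * s′) (common k ω) ⟩
        ∑[ γ < n ] (d * s′) + ∑[ γ < n ] common k ω γ       ≡⟨ cong₂ _+_ (∑-const n) (∑-common k ω) ⟩
        n * (d * s′) + s * s                                 ∎
      double : ∀ n s d → n * s + n * (s + 2 * d * s) ≡ 2 * (n * (s + d * s))
      double = solve-∀
      separate : ∀ n d s s′ → 2 * (n * (d * s′) + s * s) ≡ (s + s) * s + n * (2 * d * s′)
      separate = solve-∀

    -- The goal of the growth argument, kept as an alternative in the lemmas below because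
    -- `expansion` requires 2s ≤ n.
    Large : ℕ → Set
    Large k = n < size k + size k

    large-mono : ∀ {j k} → j ≤ k → Large j → Large k
    large-mono j≤k large = <-≤-trans large (+-mono-≤ (size-mono-≤ j≤k) (size-mono-≤ j≤k))

    -- Each step raises 2d times the size by at least the current size, hence by at least s(k):
    -- growth linear in `j`.
    growth : ∀ k j → Large (j + k) ⊎ (j + 2 * d) * size k ≤ 2 * d * size (j + k)
    growth k zero = inj₂ ≤-refl
    growth k (suc j) with growth k j
    ... | inj₁ large = inj₁ (large-mono (n≤1+n (j + k)) large)
    ... | inj₂ ih with size (j + k) + size (j + k) ≤? n
    ...   | no  2s≰n = inj₁ (large-mono (n≤1+n (j + k)) (≰⇒> 2s≰n))
    ...   | yes 2s≤n = inj₂ (≤-trans (+-mono-≤ (size-mono-≤ (m≤n+m k j)) ih) (expansion (j + k) 2s≤n))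

    doubling : ∀ k → Large (2 * d + k) ⊎ 2 * size k ≤ size (2 * d + k)
    doubling k with size k + size k ≤? n | growth k (2 * d)
    ... | no  2s≰n | _          = inj₁ (large-mono (m≤n+m k (2 * d)) (≰⇒> 2s≰n))
    ... | yes _    | inj₁ large = inj₁ large
    -- With j = 2d the factor j + 2d is twice 2d; `expansion k` rules out d = 0.
    ... | yes 2s≤n | inj₂ grown = inj₂ (halve d (0<size k) (expansion k 2s≤n) grown)

    exponential : ∀ l → Large (l * (2 * d)) ⊎ 2 ^ l ≤ size (l * (2 * d))
    exponential zero = inj₂ (0<size 0)
    exponential (suc l) with exponential l | doubling (l * (2 * d))
    ... | inj₁ large | _          = inj₁ (large-mono (m≤n+m _ (2 * d)) large)
    ... | inj₂ _     | inj₁ large = inj₁ large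
    ... | inj₂ 2^l≤s | inj₂ 2s≤s′ = inj₂ (≤-trans (*-monoʳ-≤ 2 2^l≤s) 2s≤s′)

    directed-within : ∀ l → n < 2 ^ suc l →
                      ∀ α β → Within {R = Edge Γ} (l * (2 * d) + l * (2 * d)) α β
    directed-within l n<2^1+l = balls-meet (l * (2 * d)) large
      where
      large : Large (l * (2 * d))
      large with exponential l
      ... | inj₁ large = large
      ... | inj₂ 2^l≤s = <-≤-trans n<2^1+l
              (+-mono-≤ 2^l≤s (≤-trans (≤-reflexive (+-identityʳ (2 ^ l))) 2^l≤s))

theorem1p2 : ∃[ C ] (0 < C × (∀ (n : ℕ) → .{{_ : NonZero n}} → (Γ : Digraph n) →
    Connected Γ → VertexTransitive Γ →
    ∃[ D ] ∃[ d ] (IsDirectedDiameter Γ D × IsDiameter Γ d ×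
    D ≤ C * d ^ 2 *[log₂ n ]²)))
-- The 4 comes from two radii, each of 2d steps per doubling.
theorem1p2 = 4 , s≤s z≤n , bound
  where
  bound : ∀ n → .{{_ : NonZero n}} → (Γ : Digraph n) → Connected Γ → VertexTransitive Γ →
          ∃[ D ] ∃[ d ] (IsDirectedDiameter Γ D × IsDiameter Γ d × D ≤ 4 * d ^ 2 *[log₂ n ]²)
  bound n@(suc m) Γ connected transitive
    -- `EqClosure` unfolds to `Star` of `SymClosure`, so `connected` itself supplies the undirected
    -- walks.
    with 2^-bracket m | maxDistance (symClosure? (edge? Γ)) connected
  ... | l , 2^l≤n , n<2^1+l | d , d-max = D , d , D-max , d-max ,
    linear⇒≤*log² D d l 2^l≤n
      (subst (D ≤_) (regroup l d) (within⇒maxDistance≤ D-max directed))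
    where
    directed : ∀ α β → Within {R = Edge Γ} (l * (2 * d) + l * (2 * d)) α β
    directed = Balls.directed-within Γ transitive zero (maxDistance⇒within d-max) l n<2^1+l
    -- Strong connectivity is a product of the ball argument: the walks in `directed` make all
    -- directed distances finite.
    directedDiameter : ∃[ D ] IsDirectedDiameter Γ D
    directedDiameter = maxDistance (edge? Γ) (λ α β → proj₁ (directed α β))
    D = proj₁ directedDiameter
    D-max = proj₂ directedDiameter
    regroup : ∀ l d → l * (2 * d) + l * (2 * d) ≡ 4 * d * l
    regroup = solve-∀
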